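{- For all integers $k\ge 2$ and $n\ge 1$, $$\mathrm{spt}k_d(n)+\mathrm{spt}(k-1)_d(n)=\mathrm{spt}(k-1)_d(n-k+1)+p_d(n-k+1).$$
   Context: For a partition $\pi$, $s(\pi)$ denotes its smallest part. For $j\ge1$, $\mathrm{Spt}j_d(n)$ is the set of partitions $\pi$ of $n$ in which the smallest part $s(\pi)$ occurs exactly $j$ times and all remaining parts (those larger than $s(\pi)$) are pairwise distinct; $\mathrm{spt}j_d(n)=|\mathrm{Spt}j_d(n)|$, with $\mathrm{spt}j_d(n)=0$ for $n\le 0$. $p_d(n)$ is the number of partitions of $n$ into distinct parts, with $p_d(0)=1$ and $p_d(n)=0$ for $n<0$. -}

module Defs where

open import Data.Empty using (⊥)
open import Data.Integer.Base using (ℤ; +_; -[1+_])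
open import Data.List.Base using (List; []; _∷_; _++_; map; filter; length)
open import Data.List.Extrema.Nat using (min)
open import Data.List.Membership.Propositional using (_∈_)
open import Data.List.Membership.Propositional.Properties using (∈-map⁺; ∈-map⁻; ∈-++⁺ˡ; ∈-++⁺ʳ; ∈-++⁻; ∈-filter⁺; ∈-filter⁻)
open import Data.List.Relation.Unary.All using (All; []; _∷_; all?)
open import Data.List.Relation.Unary.AllPairs using ([]; _∷_)
open import Data.List.Relation.Unary.Any using (here)
open import Data.List.Relation.Unary.Linked using (Linked; linked?)
open import Data.List.Relation.Unary.Unique.Propositional using (Unique)
import Data.List.Relation.Unary.Unique.Propositional.Properties as Unique
open import Data.Nat.Base using (ℕ; zero; suc; _≤_; _≥_; z≤n; s≤s)
open import Data.Nat.ListAction using (sum)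
open import Data.Nat.Properties using (_≟_; _≤?_; _<?_; _≥?_; suc-injective)
open import Data.List.Relation.Unary.Unique.DecPropositional _≟_ using (unique?)
open import Data.Product.Base using (_×_; _,_; proj₂)
open import Data.Sum.Base using (inj₁; inj₂)
open import Function.Bundles using (_⇔_; mk⇔)
open import Relation.Binary.PropositionalEquality using (_≡_; refl; cong)
open import Relation.Nullary.Decidable using (_×-dec_)
open import Relation.Unary using (Decidable)

IsPartition : ℕ → List ℕ → Set
IsPartition n π = All (1 ≤_) π × Linked _≥_ π × sum π ≡ n

-- The empty partition has no smallest part; 0 is a dummy value, which never
-- occurs as a part.
s : List ℕ → ℕ
s []       = 0
s (x ∷ xs) = min x xs

multiplicity : ℕ → List ℕ → ℕ
multiplicity a π = length (filter (_≟ a) π)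

-- Since s [] occurs 0 times in [], the empty partition is excluded for j ≥ 1.
Spt : ℕ → ℕ → List ℕ → Set
Spt j n π = IsPartition n π × multiplicity (s π) π ≡ j × Unique (filter (s π <?_) π)

DistinctPartition : ℕ → List ℕ → Set
DistinctPartition n π = IsPartition n π × Unique π

isPartition? : ∀ n → Decidable (IsPartition n)
isPartition? n π = all? (1 ≤?_) π ×-dec linked? _≥?_ π ×-dec (sum π ≟ n)

spt? : ∀ j n → Decidable (Spt j n)
spt? j n π = isPartition? n π ×-dec (multiplicity (s π) π ≟ j) ×-dec unique? (filter (s π <?_) π)

distinctPartition? : ∀ n → Decidable (DistinctPartition n)
distinctPartition? n π = isPartition? n π ×-dec unique? π

incHead : List ℕ → List ℕ
incHead []       = []
incHead (x ∷ xs) = suc x ∷ xs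

-- All lists of positive integers with sum n, each listed once: the first entry
-- of a composition of 2 + n is either 1 or one more than a positive integer.
compositions : ℕ → List (List ℕ)
compositions zero          = [] ∷ []
compositions (suc zero)    = (1 ∷ []) ∷ []
compositions (suc (suc n)) = map (1 ∷_) (compositions (suc n)) ++ map incHead (compositions (suc n))

-- The number of compositions of n satisfying P. When P implies IsPartition n,
-- this is the cardinality of P, by Spt-enumeration,
-- DistinctPartition-enumeration and compositions-unique below.
card : ∀ {P : List ℕ → Set} → Decidable P → ℕ → ℕ
card P? n = length (filter P? (compositions n))

sptd : ℕ → ℤ → ℕ
sptd j (+ zero)    = 0
sptd j (+ (suc n)) = card (spt? j (suc n)) (suc n)
sptd j -[1+ _ ]    = 0

p-d : ℤ → ℕ
p-d (+ n)    = card (distinctPartition? n) n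
p-d -[1+ _ ] = 0

private
  sound-step : ∀ {n π} (cs : List (List ℕ)) →
               (∀ {ρ} → ρ ∈ cs → All (1 ≤_) ρ × sum ρ ≡ suc n) →
               π ∈ map (1 ∷_) cs ++ map incHead cs →
               All (1 ≤_) π × sum π ≡ suc (suc n)
  sound-step cs ih π∈ with ∈-++⁻ (map (1 ∷_) cs) π∈
  sound-step cs ih π∈ | inj₁ π∈₁ with ∈-map⁻ (1 ∷_) π∈₁
  ... | _ , ρ∈ , refl with ih ρ∈
  ...   | pos , Σ≡ = s≤s z≤n ∷ pos , cong suc Σ≡
  sound-step cs ih π∈ | inj₂ π∈₂ with ∈-map⁻ incHead π∈₂
  ... | ρ , ρ∈ , refl with ρ | ih ρ∈
  ...   | []    | _ , ()
  ...   | _ ∷ _ | _ ∷ pos , Σ≡ = s≤s z≤n ∷ pos , cong suc Σ≡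

compositions-sound : ∀ n {π} → π ∈ compositions n → All (1 ≤_) π × sum π ≡ n
compositions-sound zero          (here refl) = [] , refl
compositions-sound (suc zero)    (here refl) = s≤s z≤n ∷ [] , refl
compositions-sound (suc (suc n)) =
  sound-step (compositions (suc n)) (compositions-sound (suc n))

compositions-complete : ∀ n {π} → All (1 ≤_) π → sum π ≡ n → π ∈ compositions n
compositions-complete zero {[]}          _        _ = here refl
compositions-complete zero {zero ∷ _}    (() ∷ _) _
compositions-complete (suc zero) {zero ∷ _}               (() ∷ _)     _
compositions-complete (suc zero) {suc zero ∷ []}          _            _ = here refl
compositions-complete (suc zero) {suc zero ∷ zero ∷ _}    (_ ∷ () ∷ _) _
compositions-complete (suc (suc n)) {zero ∷ _}         (() ∷ _)  _
compositions-complete (suc (suc n)) {suc zero ∷ π}     (_ ∷ pos) Σ≡ =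
  ∈-++⁺ˡ (∈-map⁺ (1 ∷_) (compositions-complete (suc n) pos (suc-injective Σ≡)))
compositions-complete (suc (suc n)) {suc (suc x) ∷ π} (_ ∷ pos) Σ≡ =
  ∈-++⁺ʳ (map (1 ∷_) (compositions (suc n)))
    (∈-map⁺ incHead (compositions-complete (suc n) (s≤s z≤n ∷ pos) (suc-injective Σ≡)))

compositions-unique : ∀ n → Unique (compositions n)
compositions-unique zero          = [] ∷ []
compositions-unique (suc zero)    = [] ∷ []
compositions-unique (suc (suc n)) =
  Unique.++⁺ (Unique.map⁺ (λ { refl → refl }) (compositions-unique (suc n)))
             (Unique.map⁺ incHead-injective (compositions-unique (suc n)))
             disjoint
  where
  incHead-injective : ∀ {xs ys} → incHead xs ≡ incHead ys → xs ≡ ys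
  incHead-injective {[]}    {[]}    _    = refl
  incHead-injective {_ ∷ _} {_ ∷ _} refl = refl

  disjoint : ∀ {π} → (π ∈ map (1 ∷_) (compositions (suc n)) × π ∈ map incHead (compositions (suc n))) → ⊥
  disjoint (π∈₁ , π∈₂) with ∈-map⁻ (1 ∷_) π∈₁ | ∈-map⁻ incHead π∈₂
  ... | _ , _ , refl | (zero ∷ _) , ρ∈ , refl with compositions-sound (suc n) ρ∈
  ...   | () ∷ _ , _

Spt-enumeration : ∀ j n {π} → π ∈ filter (spt? j n) (compositions n) ⇔ Spt j n π
Spt-enumeration j n = mk⇔
  (λ π∈ → proj₂ (∈-filter⁻ (spt? j n) {xs = compositions n} π∈))
  (λ { p@((pos , _ , Σ≡) , _) → ∈-filter⁺ (spt? j n) (compositions-complete n pos Σ≡) p })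

DistinctPartition-enumeration : ∀ n {π} → π ∈ filter (distinctPartition? n) (compositions n) ⇔ DistinctPartition n π
DistinctPartition-enumeration n = mk⇔
  (λ π∈ → proj₂ (∈-filter⁻ (distinctPartition? n) {xs = compositions n} π∈))
  (λ { p@((pos , _ , Σ≡) , _) → ∈-filter⁺ (distinctPartition? n) (compositions-complete n pos Σ≡) p })

{-# OPTIONS --safe #-}
-- Write j = k - 1.  Both sides count the lists E ++ replicate j a with a ≥ 1, E strictly
-- decreasing, all entries of E at least a, and total sum n.  On the left one asks whether a
-- occurs in E (the smallest part then occurs k times in all) or not (it occurs j times).
-- On the right one asks whether a = 1, so that E is an arbitrary distinct partition of n - j,
-- or a ≥ 2, so that lowering the j final entries by one gives an element of Spt j (n - j).
module Submission where

open import Defs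
open import Data.Nat.Base using (ℕ; zero; suc; _+_; _*_; _∸_; _≤_; _<_; _>_; _≥_; z≤n; s≤s)
open import Data.Nat.ListAction using (sum)
open import Data.Nat.ListAction.Properties using (sum-++)
open import Data.Nat.Properties
open import Data.Integer.Base as ℤ using (+_; _⊖_)
import Data.Integer.Properties as ℤ
open import Data.List.Base using (List; []; _∷_; _++_; _∷ʳ_; map; filter; length; replicate)
open import Data.List.Extrema.Nat using (min≤⊤; min≤xs; argmin-sel)
open import Data.List.Membership.Propositional using (_∈_)
open import Data.List.Membership.Propositional.Properties using (∈-++⁺ˡ; ∈-++⁺ʳ; ∈-++⁻; ∈-map⁺; ∈-map⁻)
open import Data.List.Membership.Propositional.Properties.WithK using (unique∧set⇒bag)
open import Data.List.Properties using (++-identityʳ; ++-cancelʳ; ∷ʳ-++; length-++; length-map; length-replicate; filter-++; filter-all; filter-none; filter-accept; filter-reject; ∷-injective; ∷-injectiveˡ)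
open import Data.List.Relation.Binary.BagAndSetEquality using (∼bag⇒↭)
open import Data.List.Relation.Binary.Permutation.Propositional.Properties using (↭-length)
open import Data.List.Relation.Unary.All as All using (All; []; _∷_)
import Data.List.Relation.Unary.All.Properties as All
open import Data.List.Relation.Unary.AllPairs as AllPairs using (AllPairs; []; _∷_)
import Data.List.Relation.Unary.AllPairs.Properties as AllPairs
open import Data.List.Relation.Unary.Any using (here; there)
open import Data.List.Relation.Unary.Linked using (Linked)
open import Data.List.Relation.Unary.Linked.Properties using (Linked⇒AllPairs; AllPairs⇒Linked)
open import Data.List.Relation.Unary.Unique.Propositional using (Unique)
import Data.List.Relation.Unary.Unique.Propositional.Properties as Unique
open import Data.Product.Base using (_×_; _,_; proj₁; proj₂)
open import Data.Sum.Base using (_⊎_; inj₁; inj₂)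
open import Function.Base using (_∘_)
open import Function.Bundles using (_⇔_; mk⇔; module Equivalence)
open import Relation.Binary.Core using (Rel)
open import Level using (0ℓ)
open import Relation.Binary.PropositionalEquality using (_≡_; refl; sym; trans; cong; cong₂; subst; module ≡-Reasoning)
open import Relation.Nullary.Decidable using (yes; no)
open import Relation.Nullary.Negation using (¬_; contradiction)

open Equivalence using (to; from)

-- Lists

module _ {A B : Set} {f : A → B} where

  -- Injectivity on the entries of `xs` is enough. This form suits `raise j`, which is injective on
  -- `Spt j m` but not on all lists.
  Unique-map⁺-local : ∀ {xs} → (∀ {x y} → x ∈ xs → y ∈ xs → f x ≡ f y → x ≡ y) →
                      Unique xs → Unique (map f xs)
  Unique-map⁺-local inj []           = []
  Unique-map⁺-local inj (x∉xs ∷ xs!) =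
    All.map⁺ (All.tabulate λ y∈ fx≡fy → All.lookup x∉xs y∈ (inj (here refl) (there y∈) fx≡fy))
    ∷ Unique-map⁺-local (λ x∈ y∈ → inj (there x∈) (there y∈)) xs!

-- Without repetitions every element occurs at most once in each list, so equality as sets is
-- already equality as bags, and the lists are permutations of each other.
Unique-length-≡ : ∀ {A : Set} {xs ys : List A} → Unique xs → Unique ys →
                  (∀ {x} → x ∈ xs ⇔ x ∈ ys) → length xs ≡ length ys
Unique-length-≡ xs! ys! xs⇔ys = ↭-length (∼bag⇒↭ (unique∧set⇒bag xs! ys! xs⇔ys))

++-injective : ∀ {A : Set} (xs xs′ : List A) {ys ys′} → length xs ≡ length xs′ →
               xs ++ ys ≡ xs′ ++ ys′ → xs ≡ xs′ × ys ≡ ys′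
++-injective []       []         _ eq = refl , eq
++-injective (x ∷ xs) (x′ ∷ xs′) l eq with ∷-injective eq
... | refl , eq′ with ++-injective xs xs′ (suc-injective l) eq′
...   | refl , ys≡ = refl , ys≡

-- The constant tails have equal length, which forces `D` and `E` to have equal length; comparing
-- the heads of the nonempty tails then gives `a ≡ b`.
++-replicate-injective : ∀ {A : Set} i (D E : List A) {a b} →
                         D ++ replicate (suc i) a ≡ E ++ replicate (suc i) b → D ≡ E × a ≡ b
++-replicate-injective i D E {a} {b} eq with ++-injective D E length≡ eq
  where
  length-snoc : ∀ D {a} → length (D ++ replicate (suc i) a) ≡ length D + suc i
  length-snoc D = trans (length-++ D) (cong (_+_ (length D)) (length-replicate (suc i)))

  length≡ : length D ≡ length E
  length≡ = +-cancelʳ-≡ (suc i) _ _ (trans (sym (length-snoc D)) (trans (cong length eq) (length-snoc E)))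
... | D≡E , reps≡ = D≡E , ∷-injectiveˡ reps≡

sum-replicate : ∀ r a → sum (replicate r a) ≡ r * a
sum-replicate zero    a = refl
sum-replicate (suc r) a = cong (_+_ a) (sum-replicate r a)

sum-++-replicate : ∀ D r a → sum (D ++ replicate r a) ≡ sum D + r * a
sum-++-replicate D r a = trans (sum-++ D (replicate r a)) (cong (_+_ (sum D)) (sum-replicate r a))

All-∷ʳ⁺ : ∀ {P : ℕ → Set} {D a} → All P D → P a → All P (D ∷ʳ a)
All-∷ʳ⁺ pD pa = All.++⁺ pD (pa ∷ [])

AllPairs-++-replicate⁺ : ∀ {_~_ : Rel ℕ 0ℓ} {D a} r → a ~ a → AllPairs _~_ D → All (_~ a) D →
                         AllPairs _~_ (D ++ replicate r a)
AllPairs-++-replicate⁺ {_~_} {a = a} r a~a D↓ D~a =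
  AllPairs.++⁺ D↓ (reps r) (All.map (All.replicate⁺ r) D~a)
  where
  reps : ∀ r → AllPairs _~_ (replicate r a)
  reps zero    = []
  reps (suc r) = All.replicate⁺ r a~a ∷ reps r

-- The smallest part

s≤parts : ∀ π → All (s π ≤_) π
s≤parts []       = []
s≤parts (x ∷ xs) = min≤⊤ x xs ∷ min≤xs x xs

s∈parts : ∀ x xs → s (x ∷ xs) ∈ x ∷ xs
s∈parts x xs with argmin-sel (λ y → y) x xs
... | inj₁ eq  = here eq
... | inj₂ s∈ = there s∈

s-unique : ∀ {a π} → a ∈ π → All (a ≤_) π → s π ≡ a
s-unique {π = x ∷ xs} a∈ a≤ =
  ≤-antisym (All.lookup (s≤parts (x ∷ xs)) a∈) (All.lookup a≤ (s∈parts x xs))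

module _ {a D} (r : ℕ) (a<D : All (a <_) D) where

  private π = D ++ replicate r a

  filter-larger : filter (a <?_) π ≡ D
  filter-larger = begin
    filter (a <?_) π                                        ≡⟨ filter-++ (a <?_) D _ ⟩
    filter (a <?_) D ++ filter (a <?_) (replicate r a)      ≡⟨ cong₂ _++_ (filter-all (a <?_) a<D) (filter-none (a <?_) (All.replicate⁺ r (<-irrefl refl))) ⟩
    D ++ []                                                 ≡⟨ ++-identityʳ D ⟩
    D                                                       ∎
    where open ≡-Reasoning

  multiplicity-replicate : multiplicity a π ≡ r
  multiplicity-replicate = trans (cong length filter-equal) (length-replicate r)
    where
    filter-equal : filter (_≟ a) π ≡ replicate r a
    filter-equal = trans (filter-++ (_≟ a) D _)
      (cong₂ _++_ (filter-none (_≟ a) (All.map (λ a<x x≡a → <-irrefl (sym x≡a) a<x) a<D))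
                  (filter-all (_≟ a) (All.replicate⁺ r refl)))

s-++-replicate : ∀ {a D} r → All (a <_) D → s (D ++ replicate (suc r) a) ≡ a
s-++-replicate {a} {D} r a<D =
  s-unique (∈-++⁺ʳ D (here refl)) (All.++⁺ (All.map <⇒≤ a<D) (All.replicate⁺ (suc r) ≤-refl))

-- In a weakly decreasing list the copies of a lower bound all stand at the end. Allowing any lower
-- bound `c`, not only `s π`, lets the induction pass to the tail, whose own minimum may differ.
split-at-lower-bound : ∀ {c π} → AllPairs _≥_ π → All (c ≤_) π →
                       π ≡ filter (c <?_) π ++ replicate (multiplicity c π) c
split-at-lower-bound {c} {[]} [] [] = refl
split-at-lower-bound {c} {x ∷ π} (x≥ ∷ π↓) (c≤x ∷ c≤π) with c ≟ x
-- Once the head equals `c`, all later entries are at most `c`, so nothing larger than `c` remains.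
... | yes refl
      rewrite filter-reject (c <?_) {xs = π} (<-irrefl {c} refl) | filter-accept (_≟ c) {xs = π} (refl {x = c})
            | filter-none (c <?_) (All.map ≤⇒≯ x≥)
      = cong (c ∷_) (subst (λ ρ → π ≡ ρ ++ replicate (multiplicity c π) c)
                           (filter-none (c <?_) (All.map ≤⇒≯ x≥)) (split-at-lower-bound π↓ c≤π))
... | no c≢x
      rewrite filter-accept (c <?_) {xs = π} (≤∧≢⇒< c≤x c≢x) | filter-reject (_≟ c) {xs = π} (c≢x ∘ sym)
      = cong (x ∷_) (split-at-lower-bound π↓ c≤π)

-- Lists with a repeated tail

-- With `_<_` and `r ≥ 1` this describes `Spt r n`; with `_≤_` it is the common set that both sides
-- of the identity count, where `a` may occur once more as the last entry of `D`.
data RepeatedTail (_≲_ : Rel ℕ 0ℓ) (r n : ℕ) : List ℕ → Set where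
  repeatedTail : ∀ a D → 1 ≤ a → AllPairs _>_ D → All (a ≲_) D → sum D + r * a ≡ n →
                 RepeatedTail _≲_ r n (D ++ replicate r a)

Unique⇒strict : ∀ {π} → AllPairs _≥_ π → Unique π → AllPairs _>_ π
Unique⇒strict π↓ π! = AllPairs.zipWith (λ (x≥y , x≢y) → ≤∧≢⇒< x≥y (x≢y ∘ sym)) (π↓ , π!)

strict⇒Unique : ∀ {π} → AllPairs _>_ π → Unique π
strict⇒Unique = AllPairs.map >⇒≢

Linked⇒AllPairs-≥ : ∀ {π} → Linked _≥_ π → AllPairs _≥_ π
Linked⇒AllPairs-≥ = Linked⇒AllPairs (λ x≥y y≥z → ≤-trans y≥z x≥y)

Spt-split : ∀ {j n π} → Spt j n π → π ≡ filter (s π <?_) π ++ replicate j (s π)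
Spt-split {π = π} ((_ , π↓ , _) , refl , _) = split-at-lower-bound (Linked⇒AllPairs-≥ π↓) (s≤parts π)

Spt⇒RepeatedTail : ∀ {i n π} → Spt (suc i) n π → RepeatedTail _<_ (suc i) n π
Spt⇒RepeatedTail {π = []} (_ , () , _)
Spt⇒RepeatedTail {i} {n} {π@(x ∷ xs)} p@((pos , π↓ , Σ≡) , _ , D!) =
  subst (RepeatedTail _<_ (suc i) n) (sym (Spt-split p))
    (repeatedTail (s π) D (All.lookup pos (s∈parts x xs))
      (Unique⇒strict (AllPairs.filter⁺ (s π <?_) (Linked⇒AllPairs-≥ π↓)) D!)
      (All.all-filter (s π <?_) π)
      (trans (sym (sum-++-replicate D (suc i) (s π))) (trans (cong sum (sym (Spt-split p))) Σ≡)))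
  where D = filter (s π <?_) π

RepeatedTail⇒Spt : ∀ {i n π} → RepeatedTail _<_ (suc i) n π → Spt (suc i) n π
RepeatedTail⇒Spt {i} (repeatedTail a D 1≤a D↓ a<D Σ≡) =
    ( All.++⁺ (All.map (≤-trans 1≤a ∘ <⇒≤) a<D) (All.replicate⁺ (suc i) 1≤a)
    , AllPairs⇒Linked (AllPairs-++-replicate⁺ (suc i) ≤-refl (AllPairs.map <⇒≤ D↓) (All.map <⇒≤ a<D))
    , trans (sum-++-replicate D (suc i) a) Σ≡)
  , trans (cong (λ c → multiplicity c π) sπ≡a) (multiplicity-replicate (suc i) a<D)
  , subst Unique (sym (trans (cong (λ c → filter (c <?_) π) sπ≡a) (filter-larger (suc i) a<D))) (strict⇒Unique D↓)
  where
  π = D ++ replicate (suc i) a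
  sπ≡a = s-++-replicate i a<D

DistinctPartition⇔ : ∀ {n π} → DistinctPartition n π ⇔ (All (1 ≤_) π × AllPairs _>_ π × sum π ≡ n)
DistinctPartition⇔ = mk⇔
  (λ ((pos , π↓ , Σ≡) , π!) → pos , Unique⇒strict (Linked⇒AllPairs-≥ π↓) π! , Σ≡)
  (λ (pos , π↓ , Σ≡) → (pos , AllPairs⇒Linked (AllPairs.map <⇒≤ π↓) , Σ≡) , strict⇒Unique π↓)

-- A strictly decreasing list bounded below by `c` can contain `c` only once, as its last entry.
data LastView (c : ℕ) : List ℕ → Set where
  above : ∀ {E} → All (c <_) E → LastView c E
  ends  : ∀ {D} → AllPairs _>_ D → All (c <_) D → LastView c (D ∷ʳ c)

lastView : ∀ {c E} → AllPairs _>_ E → All (c ≤_) E → LastView c E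
lastView [] [] = above []
lastView {c} {x ∷ E} (x> ∷ E↓) (c≤x ∷ c≤E) with lastView E↓ c≤E
... | ends D↓ c<D = ends (All.++⁻ˡ _ x> ∷ D↓) (All.head (All.++⁻ʳ _ x>) ∷ c<D)
... | above c<E with c ≟ x
...   | no c≢x = above (≤∧≢⇒< c≤x c≢x ∷ c<E)
-- The head is `c` while all later entries exceed `c`. As the list decreases, there can be no later
-- entry.
lastView {c} {x ∷ []}    _                _           | above _           | yes refl = ends [] []
lastView {c} {x ∷ y ∷ _} ((x>y ∷ _) ∷ _) _           | above (c<y ∷ _) | yes refl = contradiction x>y (<-asym c<y)

∷ʳ-sum : ∀ D r a → sum (D ∷ʳ a) + r * a ≡ sum D + suc r * a
∷ʳ-sum D r a = begin
  sum (D ∷ʳ a) + r * a      ≡⟨ cong (_+ r * a) (sum-++-replicate D 1 a) ⟩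
  sum D + 1 * a + r * a     ≡⟨ +-assoc (sum D) _ _ ⟩
  sum D + (1 * a + r * a)   ≡⟨ cong (λ b → sum D + (b + r * a)) (*-identityˡ a) ⟩
  sum D + suc r * a         ∎
  where open ≡-Reasoning

-- If the last entry of the strictly decreasing front equals `a`, it joins the tail and makes
-- `suc j` copies; otherwise every entry of the front exceeds `a` and the tail stays as it is.
RepeatedTail-≤⇔< : ∀ {j n π} → RepeatedTail _≤_ j n π ⇔ (RepeatedTail _<_ (suc j) n π ⊎ RepeatedTail _<_ j n π)
RepeatedTail-≤⇔< {j} {n} = mk⇔ ⇒ ⇐
  where
  ⇒ : ∀ {π} → RepeatedTail _≤_ j n π → RepeatedTail _<_ (suc j) n π ⊎ RepeatedTail _<_ j n π
  ⇒ (repeatedTail a E 1≤a E↓ a≤E Σ≡) with lastView E↓ a≤E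
  ... | above a<E = inj₂ (repeatedTail a E 1≤a E↓ a<E Σ≡)
  ... | ends {D} D↓ a<D = inj₁ (subst (RepeatedTail _<_ (suc j) n) (sym (∷ʳ-++ D a (replicate j a)))
                            (repeatedTail a D 1≤a D↓ a<D (trans (sym (∷ʳ-sum D j a)) Σ≡)))

  ⇐ : ∀ {π} → RepeatedTail _<_ (suc j) n π ⊎ RepeatedTail _<_ j n π → RepeatedTail _≤_ j n π
  ⇐ (inj₂ (repeatedTail a D 1≤a D↓ a<D Σ≡)) = repeatedTail a D 1≤a D↓ (All.map <⇒≤ a<D) Σ≡
  ⇐ (inj₁ (repeatedTail a D 1≤a D↓ a<D Σ≡)) =
    subst (RepeatedTail _≤_ j n) (∷ʳ-++ D a (replicate j a))
      (repeatedTail a (D ∷ʳ a) 1≤a (AllPairs.++⁺ D↓ ([] ∷ []) (All.map (_∷ []) a<D))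
        (All-∷ʳ⁺ (All.map <⇒≤ a<D) ≤-refl) (trans (∷ʳ-sum D j a) Σ≡))

-- Raising the smallest parts

-- Intended for lists in which `s π` occurs exactly `j` times. The raised value may then coincide
-- with the least of the larger parts.
raise : ℕ → List ℕ → List ℕ
raise j π = filter (s π <?_) π ++ replicate j (suc (s π))

raise-++-replicate : ∀ {a D} i → All (a <_) D →
                     raise (suc i) (D ++ replicate (suc i) a) ≡ D ++ replicate (suc i) (suc a)
raise-++-replicate {a} {D} i a<D rewrite s-++-replicate i a<D =
  cong (_++ replicate (suc i) (suc a)) (filter-larger (suc i) a<D)

raise-sum : ∀ σ j a → σ + j * suc a ≡ j + (σ + j * a)
raise-sum σ j a = begin
  σ + j * suc a      ≡⟨ cong (_+_ σ) (*-suc j a) ⟩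
  σ + (j + j * a)    ≡⟨ +-assoc σ j _ ⟨
  σ + j + j * a      ≡⟨ cong (_+ j * a) (+-comm σ j) ⟩
  j + σ + j * a      ≡⟨ +-assoc j σ _ ⟩
  j + (σ + j * a)    ∎
  where open ≡-Reasoning

-- The raised list determines the larger parts and `suc (s π)`, and these rebuild `π` through
-- `Spt-split`.
raise-injective : ∀ {i n π ρ} → Spt (suc i) n π → Spt (suc i) n ρ →
                  raise (suc i) π ≡ raise (suc i) ρ → π ≡ ρ
raise-injective {i} p q eq with ++-replicate-injective i _ _ eq
... | D≡E , ss≡ = trans (Spt-split p)
  (trans (cong₂ (λ D a → D ++ replicate (suc i) a) D≡E (suc-injective ss≡)) (sym (Spt-split q)))

-- Two enumerations of the same set

sptList : ℕ → ℕ → List (List ℕ)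
sptList j n = filter (spt? j n) (compositions n)

distinctList : ℕ → List (List ℕ)
distinctList n = filter (distinctPartition? n) (compositions n)

-- Here `j` is k - 1 and `m` is n - k + 1; taking `m` as the parameter and setting `n = j + m`
-- avoids subtraction.
module _ (i m : ℕ) where

  private
    j = suc i
    n = j + m

    appendOnes : List ℕ → List ℕ
    appendOnes E = E ++ replicate j 1

  left right : List (List ℕ)
  left  = sptList (suc j) n ++ sptList j n
  right = map (raise j) (sptList j m) ++ map appendOnes (distinctList m)

  left-unique : Unique left
  left-unique = Unique.++⁺ (Unique.filter⁺ (spt? (suc j) n) (compositions-unique n))
                           (Unique.filter⁺ (spt? j n) (compositions-unique n))
    -- A common element would have its smallest part both `suc j` and `j` times.
    λ (π∈₁ , π∈₂) → 1+n≢n (trans (sym (proj₁ (proj₂ (to (Spt-enumeration (suc j) n) π∈₁))))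
                                  (proj₁ (proj₂ (to (Spt-enumeration j n) π∈₂))))

  right-unique : Unique right
  right-unique = Unique.++⁺
    (Unique-map⁺-local (λ π∈ ρ∈ → raise-injective (to (Spt-enumeration j m) π∈) (to (Spt-enumeration j m) ρ∈))
                       (Unique.filter⁺ (spt? j m) (compositions-unique m)))
    (Unique.map⁺ (++-cancelʳ (replicate j 1) _ _) (Unique.filter⁺ (distinctPartition? m) (compositions-unique m)))
    disjoint
    where
    -- A raised list ends in `suc a` with `a ≥ 1`, whereas a list from `appendOnes` ends in 1.
    disjoint : ∀ {π} → ¬ (π ∈ map (raise j) (sptList j m) × π ∈ map appendOnes (distinctList m))
    disjoint (π∈₁ , π∈₂) with ∈-map⁻ (raise j) π∈₁ | ∈-map⁻ appendOnes π∈₂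
    ... | ρ , ρ∈ , refl | E , _ , eq with Spt⇒RepeatedTail (to (Spt-enumeration j m) ρ∈)
    ...   | repeatedTail a D 1≤a _ a<D _
            with ++-replicate-injective i D E (trans (sym (raise-++-replicate i a<D)) eq)
    ...     | _ , refl with () ← 1≤a

  left⇔ : ∀ {π} → π ∈ left ⇔ RepeatedTail _≤_ j n π
  left⇔ = mk⇔ ⇒ ⇐
    where
    ⇒ : ∀ {π} → π ∈ left → RepeatedTail _≤_ j n π
    ⇒ π∈ with ∈-++⁻ (sptList (suc j) n) π∈
    ... | inj₁ π∈₁ = from RepeatedTail-≤⇔< (inj₁ (Spt⇒RepeatedTail (to (Spt-enumeration (suc j) n) π∈₁)))
    ... | inj₂ π∈₂ = from RepeatedTail-≤⇔< (inj₂ (Spt⇒RepeatedTail (to (Spt-enumeration j n) π∈₂)))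

    ⇐ : ∀ {π} → RepeatedTail _≤_ j n π → π ∈ left
    ⇐ t with to RepeatedTail-≤⇔< t
    ... | inj₁ t₁ = ∈-++⁺ˡ (from (Spt-enumeration (suc j) n) (RepeatedTail⇒Spt t₁))
    ... | inj₂ t₂ = ∈-++⁺ʳ (sptList (suc j) n) (from (Spt-enumeration j n) (RepeatedTail⇒Spt t₂))

  appendOnes-sum : ∀ E → sum E + j * 1 ≡ j + sum E
  appendOnes-sum E = trans (cong (_+_ (sum E)) (*-identityʳ j)) (+-comm (sum E) j)

  right⇔ : ∀ {π} → π ∈ right ⇔ RepeatedTail _≤_ j n π
  right⇔ = mk⇔ ⇒ ⇐
    where
    ⇒ : ∀ {π} → π ∈ right → RepeatedTail _≤_ j n π
    ⇒ π∈ with ∈-++⁻ (map (raise j) (sptList j m)) π∈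
    ⇒ π∈ | inj₁ π∈₁ with ∈-map⁻ (raise j) π∈₁
    ... | ρ , ρ∈ , refl with Spt⇒RepeatedTail (to (Spt-enumeration j m) ρ∈)
    ...   | repeatedTail a D 1≤a D↓ a<D Σ≡ =
      subst (RepeatedTail _≤_ j n) (sym (raise-++-replicate i a<D))
        (repeatedTail (suc a) D (s≤s z≤n) D↓ a<D (trans (raise-sum (sum D) j a) (cong (_+_ j) Σ≡)))
    ⇒ π∈ | inj₂ π∈₂ with ∈-map⁻ appendOnes π∈₂
    ... | E , E∈ , refl with to DistinctPartition⇔ (to (DistinctPartition-enumeration m) E∈)
    -- Positivity of the parts is exactly the bound `a ≤_` for `a = 1`.
    ...   | pos , E↓ , Σ≡ = repeatedTail 1 E ≤-refl E↓ pos (trans (appendOnes-sum E) (cong (_+_ j) Σ≡))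

    ⇐ : ∀ {π} → RepeatedTail _≤_ j n π → π ∈ right
    ⇐ (repeatedTail (suc zero) E _ E↓ pos Σ≡) =
      ∈-++⁺ʳ (map (raise j) (sptList j m)) (∈-map⁺ appendOnes
        (from (DistinctPartition-enumeration m) (from DistinctPartition⇔
          (pos , E↓ , +-cancelˡ-≡ j _ _ (trans (sym (appendOnes-sum E)) Σ≡)))))
    -- The final value is at least 2, so its predecessor `a` is a legitimate part. The bound
    -- `suc a ≤ x` is `a < x` by definition, so it passes unchanged to the lowered list.
    ⇐ (repeatedTail (suc a@(suc _)) D _ D↓ a<D Σ≡) =
      ∈-++⁺ˡ (subst (_∈ map (raise j) (sptList j m)) (raise-++-replicate i a<D)
        (∈-map⁺ (raise j) (from (Spt-enumeration j m) (RepeatedTail⇒Spt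
          (repeatedTail a D (s≤s z≤n) D↓ a<D
            (+-cancelˡ-≡ j _ _ (trans (sym (raise-sum (sum D) j a)) Σ≡)))))))

  card-identity : card (spt? (suc j) n) n + card (spt? j n) n
                ≡ card (spt? j m) m + card (distinctPartition? m) m
  card-identity = begin
    length (sptList (suc j) n) + length (sptList j n)  ≡⟨ length-++ (sptList (suc j) n) ⟨
    length left                                        ≡⟨ Unique-length-≡ left-unique right-unique left⇔right ⟩
    length right                                       ≡⟨ length-++ (map (raise j) (sptList j m)) ⟩
    length (map (raise j) (sptList j m)) + length (map appendOnes (distinctList m))
      ≡⟨ cong₂ _+_ (length-map (raise j) (sptList j m)) (length-map appendOnes (distinctList m)) ⟩
    length (sptList j m) + length (distinctList m)     ∎
    where
    open ≡-Reasoning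
    left⇔right : ∀ {π} → π ∈ left ⇔ π ∈ right
    left⇔right = mk⇔ (from right⇔ ∘ to left⇔) (from left⇔ ∘ to right⇔)

-- Passage to integer arguments

-- The default value of `sptd` at 0 agrees with the count, because the only composition of 0 is
-- empty and has no part of positive multiplicity.
sptd-suc : ∀ i n → sptd (suc i) (+ n) ≡ card (spt? (suc i) n) n
sptd-suc i zero    = refl
sptd-suc i (suc n) = refl

-- Each of the r copies of the smallest part contributes at least 1 to the sum.
sptd-vanishes : ∀ i {n} → n < suc i → sptd (suc i) (+ n) ≡ 0
sptd-vanishes i {n} n<r = trans (sptd-suc i n)
  (cong length (filter-none (spt? (suc i) n) (All.universal (λ _ → r≰n ∘ r≤n ∘ Spt⇒RepeatedTail) (compositions n))))
  where
  r≰n : ¬ suc i ≤ n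
  r≰n = <⇒≱ n<r

  r≤n : ∀ {π} → RepeatedTail _<_ (suc i) n π → suc i ≤ n
  r≤n (repeatedTail (suc a) D _ _ _ Σ≡) = subst (suc i ≤_) Σ≡ (≤-trans (m≤m*n (suc i) (suc a)) (m≤n+m _ (sum D)))

n-[1+j]+1≡n⊖j : ∀ n j → + n ℤ.- + suc j ℤ.+ + 1 ≡ n ⊖ j
n-[1+j]+1≡n⊖j n j = begin
  + n ℤ.- + suc j ℤ.+ + 1   ≡⟨ cong (ℤ._+ + 1) (ℤ.m-n≡m⊖n n (suc j)) ⟩
  (n ⊖ suc j) ℤ.+ + 1       ≡⟨ ℤ.distribˡ-⊖-+-pos 1 n (suc j) ⟩
  n + 1 ⊖ suc j             ≡⟨ cong (_⊖ suc j) (+-comm n 1) ⟩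
  suc n ⊖ suc j             ≡⟨ ℤ.[1+m]⊖[1+n]≡m⊖n n j ⟩
  n ⊖ j                     ∎
  where open ≡-Reasoning

⊖-identity : ∀ i n → sptd (suc (suc i)) (+ n) + sptd (suc i) (+ n) ≡ sptd (suc i) (n ⊖ suc i) + p-d (n ⊖ suc i)
⊖-identity i n with suc i ≤? n
... | yes j≤n rewrite ℤ.⊖-≥ j≤n | sptd-suc (suc i) n | sptd-suc i n | sptd-suc i (n ∸ suc i) =
  trans (cong (λ N → card (spt? (suc (suc i)) N) N + card (spt? (suc i) N) N) (sym (m+[n∸m]≡n j≤n)))
        (card-identity i (n ∸ suc i))
-- For `n < j` all four terms are 0: on the left there is no room for the copies of the smallest
-- part, on the right the argument is negative.
... | no j≰n with n<j ← ≰⇒> j≰n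
    rewrite sptd-vanishes (suc i) (m<n⇒m<1+n n<j) | sptd-vanishes i n<j | ℤ.⊖-< n<j
    -- Exposing the positive difference as a successor turns `n ⊖ suc i` into a visibly negative
    -- integer, so the default clauses of `sptd` and `p-d` apply.
    with suc i ∸ n | m<n⇒0<n∸m n<j
...   | suc _ | _ = refl

theorem1p1 : ∀ (k n : ℕ) → 2 ≤ k → 1 ≤ n →
    sptd k (+ n) + sptd (k ∸ 1) (+ n) ≡ sptd (k ∸ 1) (+ n ℤ.- + k ℤ.+ + 1) + p-d (+ n ℤ.- + k ℤ.+ + 1)
theorem1p1 (suc (suc i)) n (s≤s (s≤s z≤n)) _ =
  trans (⊖-identity i n) (cong (λ z → sptd (suc i) z + p-d z) (sym (n-[1+j]+1≡n⊖j n (suc i))))
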